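{- There exists a cubic graph of order $450$ that contains no cycle of length $2^m$ for any $m \leq 5$ (that is, no cycle of length $4$, $8$, $16$ or $32$). Consequently $f(5) \leq 450$.
   Context: Graphs are finite and simple (no loops or multiple edges). A graph is cubic if every vertex has degree $3$; the order of a graph is its number of vertices. A cycle of length $n$ (an $n$-cycle) is a subgraph isomorphic to the $n$-cycle, not necessarily induced. For an integer $k \geq 2$, $f(k)$ denotes the smallest order of a cubic graph with no $2^m$-cycles for all $m \leq k$ (since graphs are simple, only $m \geq 2$ is relevant). -}

module Defs where

open import Data.Bool using (Bool; T)
open import Data.Fin using (Fin; toℕ)
open import Data.Fin.Subset using (Subset; ∣_∣)
open import Data.Nat using (ℕ; suc; _≤_; _^_; NonZero)
open import Data.Product using (Σ-syntax; _×_)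
open import Data.Vec using (tabulate)
open import Function.Definitions using (Injective)
open import Relation.Binary.PropositionalEquality using (_≡_)
open import Relation.Nullary using (¬_)

-- Graphs of order n are taken, up to isomorphism, on the vertex set Fin n.
-- Adjacency is Boolean-valued because the edge set is a finite set.
record Graph (n : ℕ) : Set where
  field
    adj    : Fin n → Fin n → Bool
    symm   : ∀ u v → T (adj u v) → T (adj v u)
    noLoop : ∀ u → ¬ T (adj u u)

  Adj : Fin n → Fin n → Set
  Adj u v = T (adj u v)

  neighbours : Fin n → Subset n
  neighbours u = tabulate (adj u)

  degree : Fin n → ℕ
  degree u = ∣ neighbours u ∣

IsCubic : ∀ {n} → Graph n → Set
IsCubic G = ∀ u → Graph.degree G u ≡ 3

-- An injective homomorphism from the cycle graph on 0, 1, …, ℓ - 1 into G;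
-- its image is a subgraph of G, not necessarily induced, isomorphic to the
-- ℓ-cycle.  As the graphs are simple, ℓ is at least 3.
record Cycle {n : ℕ} (G : Graph n) (ℓ : ℕ) : Set where
  open Graph G
  field
    3≤ℓ       : 3 ≤ ℓ
    vertex    : Fin ℓ → Fin n
    injective : Injective _≡_ _≡_ vertex
    step      : ∀ i j → toℕ j ≡ suc (toℕ i) → Adj (vertex i) (vertex j)
    close     : ∀ i j → suc (toℕ i) ≡ ℓ → toℕ j ≡ 0 → Adj (vertex i) (vertex j)

NoPowerOfTwoCycles : ∀ {n} → ℕ → Graph n → Set
NoPowerOfTwoCycles k G = ∀ m → m ≤ k → ¬ Cycle G (2 ^ m)

-- The graph with no vertices would satisfy both conditions vacuously, so the
-- order is required to be nonzero.
IsAdmissibleOrder : ℕ → ℕ → Set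
IsAdmissibleOrder k n =
  NonZero n × (Σ[ G ∈ Graph n ] (IsCubic G × NoPowerOfTwoCycles k G))

-- The graph of the function f: "f k is n" says that n is the smallest
-- admissible order.  Such an n is unique by antisymmetry of _≤_.
f_is_ : ℕ → ℕ → Set
f k is n = IsAdmissibleOrder k n × (∀ n′ → IsAdmissibleOrder k n′ → n ≤ n′)

module Submission where

-- Replace every vertex of the Tutte–Coxeter graph (the cubic graph of girth 8
-- on 30 vertices) by a 15-vertex gadget having three ports, at mutual distances
-- 3, 3 and 5, and no 4- or 8-cycle.  A cycle of length at most 32 that leaves a
-- gadget projects to a non-backtracking closed walk in the Tutte–Coxeter graph,
-- each step of which costs at least 4, so it can only be an 8-cycle all of whose
-- transitions join port 0 to another port.  Port 0 always leads forwards along a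
-- Hamiltonian cycle, so an 8-cycle using port 0 at each of its vertices would
-- run along the whole Hamiltonian cycle.
--
-- The least order f 5 exists constructively because admissibility of an order is
-- decidable: only finitely many adjacency matrices have to be inspected.

open import Data.Bool using (Bool; true; false; T)
open import Data.Bool.Properties using (T?)
open import Data.Empty using (⊥)
open import Data.Fin as Fin using (Fin; toℕ; combine; remQuot; _↑ˡ_; _↑ʳ_; #_)
open import Data.Fin.Patterns using (0F; 1F; 2F)
import Data.Fin.Properties as Fin
open import Data.Fin.Subset using (∣_∣)
open import Data.List using (List; []; _∷_)
open import Data.List.Membership.DecPropositional (Fin._≟_ {15}) using (_∈_; _∈?_)
open import Data.List.Relation.Unary.All as All using (All)
open import Data.List.Relation.Unary.Any using (here; there)
open import Data.Nat
open import Data.Nat.DivMod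
open import Data.Nat.Induction using (<-rec)
import Data.Nat.Properties as ℕ
open import Data.Product using (Σ; Σ-syntax; ∃; ∃-syntax; _×_; _,_; proj₁; proj₂; map₂; uncurry)
open import Data.Product.Properties using (≡-dec)
open import Data.Sum using (_⊎_; inj₁; inj₂; [_,_]; [_,_]′)
open import Data.Vec using (Vec; []; _∷_; lookup; tabulate; sum)
open import Data.Vec.Properties using (lookup∘tabulate; tabulate-cong)
open import Function using (_∘_)
open import Relation.Binary.PropositionalEquality hiding ([_])
open import Relation.Nullary
open import Relation.Nullary.Decidable using (map′; isYes; toWitness; fromWitness; from-yes)
open import Algebra.Properties.CommutativeSemigroup ℕ.+-commutativeSemigroup using (xy∙z≈xz∙y)
open import Defs

open Graph

-- Exhaustive search and the decidability of admissible orders.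

Searchable : Set → Set₁
Searchable A = ∀ {P : A → Set} → (∀ x → Dec (P x)) → Dec (∃ P)

searchable-Bool : Searchable Bool
searchable-Bool P? = map′
  (λ { (inj₁ p) → true , p ; (inj₂ p) → false , p })
  (λ { (true , p) → inj₁ p ; (false , p) → inj₂ p })
  (P? true ⊎-dec P? false)

searchable-Vec : ∀ {A} → Searchable A → ∀ n → Searchable (Vec A n)
searchable-Vec any zero    P? = map′ ([] ,_) (λ { ([] , p) → p }) (P? [])
searchable-Vec any (suc n) P? = map′
  (λ (x , xs , p) → x ∷ xs , p)
  (λ { (x ∷ xs , p) → x , xs , p })
  (any λ x → searchable-Vec any n λ xs → P? (x ∷ xs))

-- By strong induction on the witness `n`: a smaller witness, if the bounded search finds one, takes
-- over; otherwise `n` is itself least. The bound `m ≤ n` is what yields `f 5` at most 450.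
least : ∀ {P : ℕ → Set} → (∀ n → Dec (P n)) → ∀ n → P n →
        ∃[ m ] ((P m × (∀ k → P k → m ≤ k)) × m ≤ n)
least {P} P? = <-rec _ λ n rec p → search n rec p (ℕ.anyUpTo? P? n)
  where
  Least : ℕ → Set
  Least n = ∃[ m ] ((P m × (∀ k → P k → m ≤ k)) × m ≤ n)

  search : ∀ n → (∀ {k} → k < n → P k → Least k) → P n →
           Dec (∃ λ k → k < n × P k) → Least n
  search n rec p (yes (k , k<n , q)) =
    let m , isLeast , m≤k = rec k<n q
    in  m , isLeast , ℕ.≤-trans m≤k (ℕ.<⇒≤ k<n)
  search n rec p (no ¬smaller) =
    n , (p , λ k q → ℕ.≮⇒≥ λ k<n → ¬smaller (k , k<n , q)) , ℕ.≤-refl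

module _ {n} (G : Graph n) where

  IsCycle : ∀ {ℓ} → (Fin ℓ → Fin n) → Set
  IsCycle {ℓ} v =
    3 ≤ ℓ ×
    (∀ i j → v i ≡ v j → i ≡ j) ×
    (∀ i j → toℕ j ≡ suc (toℕ i) → Adj G (v i) (v j)) ×
    (∀ i j → suc (toℕ i) ≡ ℓ → toℕ j ≡ 0 → Adj G (v i) (v j))

  isCycle? : ∀ {ℓ} (v : Fin ℓ → Fin n) → Dec (IsCycle v)
  isCycle? {ℓ} v =
    3 ≤? ℓ ×-dec
    Fin.all? (λ i → Fin.all? λ j → (v i Fin.≟ v j) →-dec (i Fin.≟ j)) ×-dec
    Fin.all? (λ i → Fin.all? λ j → (toℕ j ≟ suc (toℕ i)) →-dec T? _) ×-dec
    Fin.all? (λ i → Fin.all? λ j →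
      (suc (toℕ i) ≟ ℓ) →-dec (toℕ j ≟ 0) →-dec T? _)

  -- The search runs over vectors, and a function agrees with the lookup of its tabulation only
  -- pointwise.
  isCycle-resp : ∀ {ℓ} {v w : Fin ℓ → Fin n} → (∀ i → v i ≡ w i) → IsCycle v → IsCycle w
  isCycle-resp v≗w (3≤ℓ , inj , step , close) =
    3≤ℓ ,
    (λ i j eq → inj i j (trans (v≗w i) (trans eq (sym (v≗w j))))) ,
    (λ i j eq → subst₂ (Adj G) (v≗w i) (v≗w j) (step i j eq)) ,
    (λ i j p q → subst₂ (Adj G) (v≗w i) (v≗w j) (close i j p q))

  cycle? : ∀ ℓ → Dec (Cycle G ℓ)
  cycle? ℓ = map′
    (λ (xs , 3≤ℓ , inj , step , close) → record
      { 3≤ℓ = 3≤ℓ ; vertex = lookup xs ; injective = inj _ _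
      ; step = step ; close = close })
    (λ c → let open Cycle c in
      tabulate vertex ,
      isCycle-resp (sym ∘ lookup∘tabulate vertex)
        (3≤ℓ , (λ _ _ → injective) , step , close))
    (searchable-Vec Fin.any? ℓ (isCycle? ∘ lookup))

  noPowerOfTwoCycles? : ∀ k → Dec (NoPowerOfTwoCycles k G)
  noPowerOfTwoCycles? k = map′
    (λ none m m≤k → none {m} (s≤s m≤k))
    (λ none {m} m<1+k → none m (s≤s⁻¹ m<1+k))
    (ℕ.allUpTo? (λ m → ¬? (cycle? (2 ^ m))) (suc k))

Admissible : ∀ {n} → ℕ → Graph n → Set
Admissible k G = IsCubic G × NoPowerOfTwoCycles k G

-- A graph rebuilt from its matrix agrees with the original only pointwise and carries other proofs
-- of symmetry and looplessness; neither affects admissibility.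
admissible-resp : ∀ {k n} {G H : Graph n} → (∀ u v → adj G u v ≡ adj H u v) →
                  Admissible k G → Admissible k H
admissible-resp {G = G} {H} G≗H (cubic , none) =
  (λ u → trans (cong ∣_∣ (tabulate-cong (sym ∘ G≗H u))) (cubic u)) ,
  λ m m≤k c → let open Cycle c in none m m≤k record
    { 3≤ℓ = 3≤ℓ ; vertex = vertex ; injective = injective
    ; step  = λ i j eq → subst T (sym (G≗H _ _)) (step i j eq)
    ; close = λ i j p q → subst T (sym (G≗H _ _)) (close i j p q) }

-- transport lets a refutation of B at one proof of A refute it at all of them.
Σ-dec : ∀ {A : Set} {B : A → Set} → (∀ {a a′} → B a → B a′) →
        Dec A → (∀ a → Dec (B a)) → Dec (Σ A B)
Σ-dec transport (yes a) B? = map′ (a ,_) (transport ∘ proj₂) (B? a)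
Σ-dec transport (no ¬a) B? = no (¬a ∘ proj₁)

isAdmissibleOrder? : ∀ k n → Dec (IsAdmissibleOrder k n)
isAdmissibleOrder? k n = ℕ.nonZero? n ×-dec map′
  (λ (M , simple , a) → fromMatrix M simple , a)
  (λ (G , a) → let M≗G = entry-matrix G in
    matrix G ,
    ( (λ u v → subst₂ (λ x y → T x → T y) (sym (M≗G u v)) (sym (M≗G v u)) (symm G u v))
    , λ u → noLoop G u ∘ subst T (M≗G u u) ) ,
    admissible-resp (λ u v → sym (M≗G u v)) a)
  (searchable-Vec (searchable-Vec searchable-Bool n) n λ M →
    Σ-dec {B = Admissible k ∘ fromMatrix M} (admissible-resp λ _ _ → refl)
      ((Fin.all? λ u → Fin.all? λ v → T? _ →-dec T? _) ×-dec
       (Fin.all? λ u → ¬? (T? _)))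
      λ _ → (Fin.all? λ u → _ ≟ _) ×-dec noPowerOfTwoCycles? _ k)
  where
  entry : Vec (Vec Bool n) n → Fin n → Fin n → Bool
  entry M u v = lookup (lookup M u) v

  Simple : Vec (Vec Bool n) n → Set
  Simple M = (∀ u v → T (entry M u v) → T (entry M v u)) × (∀ u → ¬ T (entry M u u))

  fromMatrix : ∀ M → Simple M → Graph n
  fromMatrix M (symm , noLoop) = record { adj = entry M ; symm = symm ; noLoop = noLoop }

  matrix : Graph n → Vec (Vec Bool n) n
  matrix G = tabulate (tabulate ∘ adj G)

  entry-matrix : ∀ G u v → entry (matrix G) u v ≡ adj G u v
  entry-matrix G u v = trans
    (cong (λ row → lookup row v) (lookup∘tabulate (tabulate ∘ adj G) u))
    (lookup∘tabulate (adj G u) v)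

-- Degrees in a graph on pairs.

∣tabulate-+∣ : ∀ m {n} (f : Fin (m + n) → Bool) →
               ∣ tabulate f ∣ ≡ ∣ tabulate (f ∘ (_↑ˡ n)) ∣ + ∣ tabulate (f ∘ (m ↑ʳ_)) ∣
∣tabulate-+∣ zero    f = refl
∣tabulate-+∣ (suc m) f with f Fin.zero
... | true  = cong suc (∣tabulate-+∣ m (f ∘ Fin.suc))
... | false = ∣tabulate-+∣ m (f ∘ Fin.suc)

∣tabulate-*∣ : ∀ m n (f : Fin (m * n) → Bool) →
               ∣ tabulate f ∣ ≡ sum (tabulate λ i → ∣ tabulate (f ∘ combine {m} i) ∣)
∣tabulate-*∣ zero    n f = refl
∣tabulate-*∣ (suc m) n f = trans (∣tabulate-+∣ n f)
  (cong (∣ tabulate (f ∘ (_↑ˡ m * n)) ∣ +_) (∣tabulate-*∣ m n (f ∘ (n ↑ʳ_))))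

-- Splits the count of neighbours into one count per gadget, so that degrees can be evaluated on
-- pairs.
degree-remQuot : ∀ m n (G : Graph (m * n)) (R : Fin m × Fin n → Fin m × Fin n → Bool) →
  (∀ u v → adj G u v ≡ R (remQuot n u) (remQuot n v)) → ∀ u →
  degree G u ≡ sum (tabulate λ i → ∣ tabulate (λ j → R (remQuot n u) (i , j)) ∣)
degree-remQuot m n G R G≗R u = trans (∣tabulate-*∣ m n (adj G u))
  (cong sum (tabulate-cong λ i → cong ∣_∣ (tabulate-cong λ j →
    trans (G≗R u (combine i j)) (cong (R (remQuot n u)) (Fin.remQuot-combine i j)))))

-- The gadget, the Tutte-Coxeter graph and the finite searches.

-- Neighbour lists of the gadget; its ports are the vertices 0, 1 and 2.
gadget : Fin 15 → List (Fin 15)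
gadget = lookup
  ( (# 3 ∷ # 4 ∷ [])
  ∷ (# 5 ∷ # 6 ∷ [])
  ∷ (# 7 ∷ # 8 ∷ [])
  ∷ (# 0 ∷ # 5 ∷ # 9 ∷ [])
  ∷ (# 0 ∷ # 7 ∷ # 12 ∷ [])
  ∷ (# 1 ∷ # 3 ∷ # 9 ∷ [])
  ∷ (# 1 ∷ # 10 ∷ # 11 ∷ [])
  ∷ (# 2 ∷ # 4 ∷ # 12 ∷ [])
  ∷ (# 2 ∷ # 13 ∷ # 14 ∷ [])
  ∷ (# 3 ∷ # 5 ∷ # 10 ∷ [])
  ∷ (# 6 ∷ # 9 ∷ # 11 ∷ [])
  ∷ (# 6 ∷ # 10 ∷ # 13 ∷ [])
  ∷ (# 4 ∷ # 7 ∷ # 14 ∷ [])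
  ∷ (# 8 ∷ # 11 ∷ # 14 ∷ [])
  ∷ (# 8 ∷ # 12 ∷ # 13 ∷ [])
  ∷ [])

-- The distances inside the gadget from each port. Vanishing at the port and growing by at most one
-- along each edge make them lower bounds for the time since entry.
portDistance : Fin 3 → Fin 15 → ℕ
portDistance p = lookup (lookup
  ( (0 ∷ 3 ∷ 3 ∷ 1 ∷ 1 ∷ 2 ∷ 4 ∷ 2 ∷ 4 ∷ 2 ∷ 3 ∷ 4 ∷ 2 ∷ 4 ∷ 3 ∷ [])
  ∷ (3 ∷ 0 ∷ 5 ∷ 2 ∷ 4 ∷ 1 ∷ 1 ∷ 5 ∷ 4 ∷ 2 ∷ 2 ∷ 2 ∷ 5 ∷ 3 ∷ 4 ∷ [])
  ∷ (3 ∷ 5 ∷ 0 ∷ 4 ∷ 2 ∷ 5 ∷ 4 ∷ 1 ∷ 1 ∷ 5 ∷ 4 ∷ 3 ∷ 2 ∷ 2 ∷ 2 ∷ [])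
  ∷ []) p)

Exit : Set
Exit = Fin 30 × Fin 3

Vertex : Set
Vertex = Fin 30 × Fin 15

-- The Tutte–Coxeter graph is [17, 21, 7, 23, 9, 13]⁵ in LCF notation.
chordOffset : Fin 6 → ℕ
chordOffset = lookup (17 ∷ 21 ∷ 7 ∷ 23 ∷ 9 ∷ 13 ∷ [])

-- Ports 0 and 1 lead forwards and backwards along the Hamiltonian cycle, port 2
-- along the chord.
partner : Exit → Exit
partner (g , 0F) = (toℕ g + 1)  mod 30 , 1F
partner (g , 1F) = (toℕ g + 29) mod 30 , 0F
partner (g , 2F) = (toℕ g + chordOffset (toℕ g mod 6)) mod 30 , 2F

port : Fin 3 → Fin 15
port = _↑ˡ 12

atPort : Exit → Vertex
atPort = map₂ port

Inside Across Step : Vertex → Vertex → Set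
Inside (g , i) (h , j) = g ≡ h × j ∈ gadget i
Across (g , i) v = ∃[ p ] (i ≡ port p × v ≡ atPort (partner (g , p)))
Step u v = Inside u v ⊎ Across u v

_≟ᵛ_ : (u v : Vertex) → Dec (u ≡ v)
_≟ᵛ_ = ≡-dec Fin._≟_ Fin._≟_

_≟ᵉ_ : (u v : Exit) → Dec (u ≡ v)
_≟ᵉ_ = ≡-dec Fin._≟_ Fin._≟_

inside? : ∀ u v → Dec (Inside u v)
inside? (g , i) (h , j) = g Fin.≟ h ×-dec j ∈? gadget i

across? : ∀ u v → Dec (Across u v)
across? (g , i) v = Fin.any? λ p → i Fin.≟ port p ×-dec v ≟ᵛ atPort (partner (g , p))

step? : ∀ u v → Dec (Step u v)
step? u v = inside? u v ⊎-dec across? u v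

-- A walk that has just entered gadget g by port p, and never leaves a gadget by its
-- port of entry, needs more than b steps to enter at t.  Fuel only makes the
-- recursion structural.
NoReturn : ℕ → ℕ → Exit → Exit → Set
NoReturn zero       b t (g , p) = ⊥
NoReturn (suc fuel) b t (g , p) =
  ∀ q → q ≢ p → suc (portDistance p (port q)) ≤ b →
  partner (g , q) ≢ t × NoReturn fuel (b ∸ suc (portDistance p (port q))) t (partner (g , q))

noReturn? : ∀ fuel b t e → Dec (NoReturn fuel b t e)
noReturn? zero       b t e       = no λ ()
noReturn? (suc fuel) b t (g , p) = Fin.all? λ q →
  ¬? (q Fin.≟ p) →-dec (_ ≤? _) →-dec
  (¬? (_ ≟ᵉ _) ×-dec noReturn? fuel _ t (partner (g , q)))

-- No path of length n from i that avoids vis ends next to s.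
NoClosing : ℕ → List (Fin 15) → Fin 15 → Fin 15 → Set
NoClosing zero    vis s i = ¬ s ∈ gadget i
NoClosing (suc n) vis s i = All (λ j → j ∈ vis ⊎ NoClosing n (j ∷ vis) s j) (gadget i)

noClosing? : ∀ n vis s i → Dec (NoClosing n vis s i)
noClosing? zero    vis s i = ¬? (s ∈? gadget i)
noClosing? (suc n) vis s i = All.all? (λ j → j ∈? vis ⊎-dec noClosing? n (j ∷ vis) s j) (gadget i)

-- Cycles as periodic walks.

-- A cycle unrolled over all times: the closing edge becomes an ordinary step, and any point can
-- serve as the start after a shift.
record Loop {A : Set} (R : A → A → Set) (ℓ : ℕ) : Set where
  field
    x        : ℕ → A
    walk     : ∀ k → R (x k) (x (suc k))
    periodic : ∀ k → x (k + ℓ) ≡ x k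
    distinct : ∀ k d → 0 < d → d < ℓ → x (k + d) ≢ x k

  no-revisit : ∀ {i j} → i < j → j < i + ℓ → x j ≢ x i
  no-revisit {i} i<j j<i+ℓ with d , refl ← ℕ.m≤n⇒∃[o]m+o≡n (ℕ.<⇒≤ i<j) =
    distinct i d (ℕ.+-cancelˡ-< i 0 d (subst (_< i + d) (sym (ℕ.+-identityʳ i)) i<j))
                 (ℕ.+-cancelˡ-< i d _ j<i+ℓ)

module _ {A : Set} {R : A → A → Set} {ℓ} (L : Loop R ℓ) where
  open Loop L

  rotate : ℕ → Loop R ℓ
  rotate c = record
    { x        = λ k → x (k + c)
    ; walk     = λ k → walk (k + c)
    ; periodic = λ k → trans (cong x (xy∙z≈xz∙y k ℓ c)) (periodic (k + c))
    ; distinct = λ k d 0<d d<ℓ eq →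
        distinct (k + c) d 0<d d<ℓ (trans (cong x (xy∙z≈xz∙y k c d)) eq)
    }

  mapLoop : ∀ {B : Set} {S : B → B → Set} (f : A → B) →
            (∀ {a b} → f a ≡ f b → a ≡ b) → (∀ a b → R a b → S (f a) (f b)) → Loop S ℓ
  mapLoop f f-injective f-step = record
    { x        = f ∘ x
    ; walk     = λ k → f-step _ _ (walk k)
    ; periodic = cong f ∘ periodic
    ; distinct = λ k d 0<d d<ℓ → distinct k d 0<d d<ℓ ∘ f-injective
    }

-- With `r = m % n`, the sum `r + d` is below `2 * n`, so its remainder is `r + d` or `r + d ∸ n`;
-- the first exceeds `r` and the second is smaller.
[m+d]%n≢m%n : ∀ m d n .{{_ : NonZero n}} → 0 < d → d < n → (m + d) % n ≢ m % n
[m+d]%n≢m%n m d n 0<d d<n eq = [ unwrapped , wrapped ] (ℕ.<-≤-connex (r + d) n)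
  where
  open ≡-Reasoning
  r = m % n

  [r+d]%n≡r : (r + d) % n ≡ r
  [r+d]%n≡r = begin
    (r + d) % n                ≡⟨ [m+kn]%n≡m%n (r + d) (m / n) n ⟨
    (r + d + m / n * n) % n    ≡⟨ cong (_% n) (xy∙z≈xz∙y r d (m / n * n)) ⟩
    (r + m / n * n + d) % n    ≡⟨ cong (λ k → (k + d) % n) (m≡m%n+[m/n]*n m n) ⟨
    (m + d) % n                ≡⟨ eq ⟩
    r                          ∎

  unwrapped : ¬ r + d < n
  unwrapped r+d<n =
    ℕ.<⇒≢ (ℕ.m<m+n r 0<d) (trans (sym [r+d]%n≡r) (m<n⇒m%n≡m r+d<n))

  wrapped : ¬ n ≤ r + d
  wrapped n≤r+d = ℕ.<⇒≢ d<n (ℕ.+-cancelˡ-≡ r d n (begin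
    r + d                ≡⟨ ℕ.m∸n+n≡m n≤r+d ⟨
    r + d ∸ n + n        ≡⟨ cong (_+ n) r+d∸n≡r ⟩
    r + n                ∎))
    where
    r+d∸n≡r : r + d ∸ n ≡ r
    r+d∸n≡r = begin
      r + d ∸ n            ≡⟨ m<n⇒m%n≡m (ℕ.m<n+o⇒m∸n<o (r + d) n (ℕ.+-mono-< (m%n<n m n) d<n)) ⟨
      (r + d ∸ n) % n      ≡⟨ [m+n]%n≡m%n (r + d ∸ n) n ⟨
      (r + d ∸ n + n) % n  ≡⟨ cong (_% n) (ℕ.m∸n+n≡m n≤r+d) ⟩
      (r + d) % n          ≡⟨ [r+d]%n≡r ⟩
      r                    ∎

unroll : ∀ {n} {G : Graph n} {ℓ} → Cycle G ℓ → Loop (Adj G) ℓ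
unroll {ℓ = zero} c with () ← Cycle.3≤ℓ c
unroll {G = G} {ℓ@(suc _)} c = record
  { x        = λ k → vertex (k mod ℓ)
  ; walk     = walk
  ; periodic = λ k → cong vertex (Fin.toℕ-injective
      (trans (toℕ-mod (k + ℓ)) (trans ([m+n]%n≡m%n k ℓ) (sym (toℕ-mod k)))))
  ; distinct = λ k d 0<d d<ℓ eq → [m+d]%n≢m%n k d ℓ 0<d d<ℓ
      (trans (sym (toℕ-mod (k + d))) (trans (cong toℕ (injective eq)) (toℕ-mod k)))
  }
  where
  open Cycle c
  open ≡-Reasoning

  toℕ-mod : ∀ k → toℕ (k mod ℓ) ≡ k % ℓ
  toℕ-mod k = Fin.toℕ-fromℕ< (m%n<n k ℓ)

  suc-% : ∀ k → suc k % ℓ ≡ suc (k % ℓ) % ℓ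
  suc-% k = trans (cong (λ m → suc m % ℓ) (m≡m%n+[m/n]*n k ℓ))
                  ([m+kn]%n≡m%n (suc (k % ℓ)) (k / ℓ) ℓ)

  walk : ∀ k → Adj G (vertex (k mod ℓ)) (vertex (suc k mod ℓ))
  -- The index increases by one unless it is the last, `ℓ - 1`, where it wraps round to 0 along the
  -- closing edge.
  walk k with ℕ.m≤n⇒m<n∨m≡n (m%n<n k ℓ)
  ... | inj₁ 1+r<ℓ = step _ _ (begin
    toℕ (suc k mod ℓ)    ≡⟨ toℕ-mod (suc k) ⟩
    suc k % ℓ            ≡⟨ suc-% k ⟩
    suc (k % ℓ) % ℓ      ≡⟨ m<n⇒m%n≡m 1+r<ℓ ⟩
    suc (k % ℓ)          ≡⟨ cong suc (toℕ-mod k) ⟨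
    suc (toℕ (k mod ℓ))  ∎)
  ... | inj₂ 1+r≡ℓ = close _ _ (trans (cong suc (toℕ-mod k)) 1+r≡ℓ) (begin
    toℕ (suc k mod ℓ)    ≡⟨ toℕ-mod (suc k) ⟩
    suc k % ℓ            ≡⟨ suc-% k ⟩
    suc (k % ℓ) % ℓ      ≡⟨ cong (_% ℓ) 1+r≡ℓ ⟩
    ℓ % ℓ                ≡⟨ n%n≡0 ℓ ⟩
    0                    ∎)

-- Finite facts verified by evaluation.

gadget-sym : ∀ i → All (λ j → i ∈ gadget j) (gadget i)
gadget-sym = from-yes (Fin.all? λ i → All.all? (λ j → i ∈? gadget j) (gadget i))

gadget-irrefl : ∀ i → ¬ i ∈ gadget i
gadget-irrefl = from-yes (Fin.all? λ i → ¬? (i ∈? gadget i))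

partner-involutive : ∀ g p → partner (partner (g , p)) ≡ (g , p)
partner-involutive = from-yes
  (Fin.all? λ g → Fin.all? λ p → partner (partner (g , p)) ≟ᵉ (g , p))

partner-irrefl : ∀ g p → proj₁ (partner (g , p)) ≢ g
partner-irrefl = from-yes
  (Fin.all? λ g → Fin.all? λ p → ¬? (proj₁ (partner (g , p)) Fin.≟ g))

portDistance-port : ∀ p → portDistance p (port p) ≡ 0
portDistance-port = from-yes (Fin.all? λ p → portDistance p (port p) ≟ 0)

portDistance-step : ∀ p i → All (λ j → portDistance p j ≤ suc (portDistance p i)) (gadget i)
portDistance-step = from-yes (Fin.all? λ p → Fin.all? λ i →
  All.all? (λ j → portDistance p j ≤? suc (portDistance p i)) (gadget i))

-- A crossing costs at least 4, so 8 crossings exhaust the budget and the ninth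
-- unit of fuel is never spent.
noReturn : ∀ g p → NoReturn 9 32 (g , p) (g , p)
noReturn = from-yes (Fin.all? λ g → Fin.all? λ p → noReturn? 9 32 (g , p) (g , p))

-- A path of length 3 or 7 whose end is adjacent to its start would be a 4-cycle or an 8-cycle.
noClosing : ∀ s → NoClosing 3 (s ∷ []) s s × NoClosing 7 (s ∷ []) s s
noClosing = from-yes (Fin.all? λ s →
  noClosing? 3 (s ∷ []) s s ×-dec noClosing? 7 (s ∷ []) s s)

degree-sum : ∀ v → sum (tabulate λ h → ∣ tabulate (λ j → isYes (step? v (h , j))) ∣) ≡ 3
degree-sum = uncurry (from-yes (Fin.all? λ g → Fin.all? λ i →
  sum (tabulate λ h → ∣ tabulate (λ j → isYes (step? (g , i) (h , j))) ∣) ≟ 3))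

-- The cubic graph of order 450.

Step-sym : ∀ u v → Step u v → Step v u
Step-sym (g , i) (h , j) (inj₁ (refl , j∈)) = inj₁ (refl , All.lookup (gadget-sym i) j∈)
Step-sym (g , _) _ (inj₂ (p , refl , refl)) =
  inj₂ (_ , refl , cong atPort (sym (partner-involutive g p)))

Step-irrefl : ∀ u → ¬ Step u u
Step-irrefl (g , i) (inj₁ (_ , i∈))     = gadget-irrefl i i∈
Step-irrefl (g , i) (inj₂ (p , _ , eq)) = partner-irrefl g p (sym (cong proj₁ eq))

decode : Fin 450 → Vertex
decode = remQuot {30} 15

decode-injective : ∀ {u v} → decode u ≡ decode v → u ≡ v
decode-injective {u} {v} eq = trans (sym (Fin.combine-remQuot {30} 15 u))
  (trans (cong (uncurry combine) eq) (Fin.combine-remQuot {30} 15 v))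

G₄₅₀ : Graph 450
G₄₅₀ = record
  { adj    = λ u v → isYes (step? (decode u) (decode v))
  ; symm   = λ u v uv → fromWitness {a? = step? (decode v) (decode u)}
      (Step-sym (decode u) (decode v) (toWitness {a? = step? (decode u) (decode v)} uv))
  ; noLoop = λ u uu → Step-irrefl (decode u) (toWitness {a? = step? (decode u) (decode u)} uu)
  }

G₄₅₀-cubic : IsCubic G₄₅₀
G₄₅₀-cubic u = trans
  (degree-remQuot 30 15 G₄₅₀ (λ v w → isYes (step? v w)) (λ _ _ → refl) u)
  (degree-sum (decode u))

-- Cycles that leave a gadget.

atPort-injective : ∀ {e e′} → atPort e ≡ atPort e′ → e ≡ e′
atPort-injective eq = cong₂ _,_ (cong proj₁ eq) (Fin.↑ˡ-injective 12 _ _ (cong proj₂ eq))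

module Crossing {ℓ} (3≤ℓ : 3 ≤ ℓ) (ℓ≤32 : ℓ ≤ 32) (L : Loop Step ℓ) where
  open Loop L

  -- At time k the walk is in the gadget that it entered by port p at time 1 + s, so
  -- the b steps of escape cover the time up to 1 + ℓ.
  record Visit (t : Exit) (k : ℕ) : Set where
    constructor visit
    g = proj₁ (x k)
    field
      p       : Fin 3
      s       : ℕ
      origin  : x s ≡ atPort (partner (g , p))
      entered : x (suc s) ≡ atPort (g , p)
      elapsed : suc s + portDistance p (proj₂ (x k)) ≤ k
      fuel b  : ℕ
      budget  : ℓ ≤ s + b
      escape  : NoReturn fuel b t (g , p)

  stay : ∀ {t k} → Visit t k → Inside (x k) (x (suc k)) → Visit t (suc k)
  stay {t} {k} (visit p s origin entered elapsed fuel b budget escape) (g≡h , j∈) =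
    visit p s
      (trans origin (cong (λ g → atPort (partner (g , p))) g≡h))
      (trans entered (cong (λ g → atPort (g , p)) g≡h))
      (begin
        suc s + portDistance p (proj₂ (x (suc k)))
          ≤⟨ ℕ.+-monoʳ-≤ (suc s) (All.lookup (portDistance-step p _) j∈) ⟩
        suc s + suc (portDistance p (proj₂ (x k)))
          ≡⟨ ℕ.+-suc (suc s) _ ⟩
        suc (suc s + portDistance p (proj₂ (x k)))
          ≤⟨ s≤s elapsed ⟩
        suc k ∎)
      fuel b budget (subst (λ g → NoReturn fuel b t (g , p)) g≡h escape)
    where open ℕ.≤-Reasoning

  -- Opens a new visit with `s = k`. The partner of the port of entry is the exit just used, which
  -- gives `origin`, and the distance from the port of entry is 0.
  arrive : ∀ {t k fuel b} q → let e = partner (proj₁ (x k) , q) in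
           proj₂ (x k) ≡ port q → x (suc k) ≡ atPort e →
           ℓ ≤ k + b → NoReturn fuel b t e → Visit t (suc k)
  arrive {t} {k} {fuel} {b} q i≡q next budget escape = visit p k
    (trans (cong (g ,_) i≡q)
      (cong atPort (trans (sym (partner-involutive g q)) (cong partner (sym e≡)))))
    (trans next (cong atPort (sym e≡)))
    (ℕ.≤-reflexive (trans
      (cong (suc k +_) (trans (cong (portDistance p ∘ proj₂) next) (portDistance-port p)))
      (ℕ.+-identityʳ (suc k))))
    fuel b budget (subst (NoReturn fuel b t) (sym e≡) escape)
    where
    g = proj₁ (x k)
    p = proj₂ (partner (g , q))

    e≡ : (proj₁ (x (suc k)) , p) ≡ partner (g , q)
    e≡ = cong (λ v → proj₁ v , p) next

  -- The time elapsed since entry covers the cost of leaving by `q`, and `k ≤ ℓ` keeps that cost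
  -- within the budget. Hence `escape` applies to `q`: it excludes arrival at `t` and supplies the
  -- search for the next visit.
  cross : ∀ {t k} → k ≤ ℓ → Visit t k → Across (x k) (x (suc k)) →
          x (suc k) ≢ atPort t × Visit t (suc k)
  cross k≤ℓ (visit p s origin entered elapsed zero b budget ()) _
  cross {t} {k} k≤ℓ (visit p s origin entered elapsed (suc fuel) b budget escape) (q , i≡q , next) =
    (λ back → proj₁ rest (atPort-injective (trans (sym next) back))) ,
    arrive q i≡q next
      (begin
        ℓ                        ≤⟨ budget ⟩
        s + b                    ≡⟨ cong (s +_) (ℕ.m+[n∸m]≡n cost≤b) ⟨
        s + (cost + (b ∸ cost))  ≡⟨ ℕ.+-assoc s cost (b ∸ cost) ⟨
        s + cost + (b ∸ cost)    ≤⟨ ℕ.+-monoˡ-≤ (b ∸ cost) s+cost≤k ⟩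
        k + (b ∸ cost)           ∎)
      (proj₂ rest)
    where
    open ℕ.≤-Reasoning

    cost = suc (portDistance p (port q))

    s+cost≤k : s + cost ≤ k
    s+cost≤k = begin
      s + cost                                 ≡⟨ ℕ.+-suc s _ ⟩
      suc s + portDistance p (port q)          ≡⟨ cong (λ i → suc s + portDistance p i) i≡q ⟨
      suc s + portDistance p (proj₂ (x k))     ≤⟨ elapsed ⟩
      k                                        ∎

    cost≤b : cost ≤ b
    cost≤b = ℕ.+-cancelˡ-≤ s cost b (ℕ.≤-trans s+cost≤k (ℕ.≤-trans k≤ℓ budget))

    -- Leaving by the port of entry would either retrace the last external edge
    -- or revisit the vertex of entry.
    q≢p : q ≢ p
    q≢p refl with ℕ.m≤n⇒m<n∨m≡n (ℕ.m+n≤o⇒m≤o (suc s) elapsed)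
    ... | inj₁ 1+s<k = no-revisit 1+s<k (s≤s (ℕ.≤-trans k≤ℓ (ℕ.m≤n+m ℓ s)))
                         (trans (cong (_ ,_) i≡q) (sym entered))
    ... | inj₂ refl  = no-revisit (ℕ.m≤n+m (suc s) 1)
                         (subst (_< s + ℓ) (ℕ.+-comm s 2) (ℕ.+-monoʳ-< s 3≤ℓ))
                         (trans next (sym origin))

    rest = escape q q≢p cost≤b

  advance : ∀ {t k} → k ≤ ℓ → Visit t k → Visit t (suc k)
  advance {k = k} k≤ℓ v = [ stay v , (λ across → proj₂ (cross k≤ℓ v across)) ]′ (walk k)

  -- By periodicity the crossing at time 0 recurs at time `ℓ` and enters at `t` again, which the
  -- visit maintained from time 1 to time `ℓ` forbids.
  ¬across : ¬ Across (x 0) (x 1)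
  ¬across across@(p , i≡p , next) =
    proj₁ (cross ℕ.≤-refl (visits ℓ (ℕ.≤-trans (s≤s z≤n) 3≤ℓ) ℕ.≤-refl)
      (subst₂ Across (sym (periodic 0)) (sym (periodic 1)) across))
      (trans (periodic 1) next)
    where
    t = partner (proj₁ (x 0) , p)

    visits : ∀ k → 0 < k → k ≤ ℓ → Visit t k
    -- The first visit starts at the target `t` itself, with `s = 0` and the whole budget of 32.
    visits (suc zero)    _ _   = arrive p i≡p next ℓ≤32 (noReturn _ _)
    visits (suc (suc k)) _ k<ℓ =
      advance (ℕ.<⇒≤ k<ℓ) (visits (suc k) (s≤s z≤n) (ℕ.<⇒≤ k<ℓ))

-- Cycles inside one gadget.

module Confined {ℓ} (L : Loop Step ℓ)
  (inside : ∀ k → k < ℓ → Inside (Loop.x L k) (Loop.x L (suc k))) where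
  open Loop L

  y : ℕ → Fin 15
  y = proj₂ ∘ x

  same-gadget : ∀ k → k ≤ ℓ → proj₁ (x k) ≡ proj₁ (x 0)
  same-gadget zero    _   = refl
  same-gadget (suc k) k<ℓ = trans (sym (proj₁ (inside k k<ℓ))) (same-gadget k (ℕ.<⇒≤ k<ℓ))

  y-distinct : ∀ {i j} → i < j → j < ℓ → y j ≢ y i
  y-distinct {i} {j} i<j j<ℓ eq = no-revisit i<j (ℕ.<-≤-trans j<ℓ (ℕ.m≤n+m ℓ i))
    (cong₂ _,_ (trans (same-gadget j (ℕ.<⇒≤ j<ℓ))
                      (sym (same-gadget i (ℕ.<⇒≤ (ℕ.<-trans i<j j<ℓ))))) eq)

  ℓ≤15 : ℓ ≤ 15
  ℓ≤15 = ℕ.≮⇒≥ λ 15<ℓ →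
    let i , j , i<j , eq = Fin.pigeonhole 15<ℓ (y ∘ toℕ)
    in  y-distinct i<j (Fin.toℕ<n j) (sym eq)

  -- The walk follows one branch of the tree explored by `NoClosing`. Since `vis` holds only earlier
  -- positions, distinctness rules out a revisit, and at the leaf the last step leads back to `y 0`.
  y-closes : ∀ n k vis → (∀ {v} → v ∈ vis → ∃[ c ] (c ≤ k × v ≡ y c)) →
             suc (k + n) ≡ ℓ → ¬ NoClosing n vis (y 0) (y k)
  y-closes zero k vis visited k+1≡ℓ none = none
    (subst (_∈ gadget (y k)) (trans (cong y 1+k≡ℓ) (cong proj₂ (periodic 0)))
      (proj₂ (inside k (ℕ.≤-reflexive 1+k≡ℓ))))
    where
    1+k≡ℓ : suc k ≡ ℓ
    1+k≡ℓ = trans (cong suc (sym (ℕ.+-identityʳ k))) k+1≡ℓ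
  y-closes (suc n) k vis visited 1+k+n≡ℓ none =
    [ revisit , y-closes n (suc k) (y (suc k) ∷ vis) visited′ 2+k+n≡ℓ ]
      (All.lookup none (proj₂ (inside k (ℕ.<⇒≤ 1+k<ℓ))))
    where
    2+k+n≡ℓ : suc (suc k + n) ≡ ℓ
    2+k+n≡ℓ = trans (cong suc (sym (ℕ.+-suc k n))) 1+k+n≡ℓ

    1+k<ℓ : suc k < ℓ
    1+k<ℓ = ℕ.≤-trans (s≤s (ℕ.m≤m+n (suc k) n)) (ℕ.≤-reflexive 2+k+n≡ℓ)

    revisit : ¬ y (suc k) ∈ vis
    revisit j∈ = let c , c≤k , eq = visited j∈ in y-distinct (s≤s c≤k) 1+k<ℓ eq

    visited′ : ∀ {v} → v ∈ y (suc k) ∷ vis → ∃[ c ] (c ≤ suc k × v ≡ y c)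
    visited′ (here eq)  = suc k , ℕ.≤-refl , eq
    visited′ (there v∈) = let c , c≤k , eq = visited v∈ in c , ℕ.m≤n⇒m≤1+n c≤k , eq

  closes : ∀ n → suc n ≡ ℓ → ¬ (∀ s → NoClosing n (s ∷ []) s s)
  closes n 1+n≡ℓ none = y-closes n 0 (y 0 ∷ [])
    (λ { (here eq) → 0 , z≤n , eq }) 1+n≡ℓ (none (y 0))

-- Excluding all lengths up to 32.

¬confined : ∀ m → 3 ≤ 2 ^ m → (L : Loop Step (2 ^ m)) →
            ¬ (∀ k → k < 2 ^ m → Inside (Loop.x L k) (Loop.x L (suc k)))
¬confined 0 (s≤s ())
¬confined 1 (s≤s (s≤s ()))
¬confined 2 _ L inside = Confined.closes L inside 3 refl (proj₁ ∘ noClosing)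
¬confined 3 _ L inside = Confined.closes L inside 7 refl (proj₂ ∘ noClosing)
-- Here `2 ^ 4 ≤ 2 ^ (4 + m)` says that the length exceeds the 15 vertices of the gadget.
¬confined (suc (suc (suc (suc m)))) _ L inside = ℕ.<⇒≱
  (ℕ.^-monoʳ-≤ 2 {4} {4 + m} (ℕ.m≤m+n 4 m)) (Confined.ℓ≤15 L inside)

-- One period is searched for a crossing. If there is one, a rotation moves it to time 0; if not,
-- the loop is confined to one gadget.
¬loop : ∀ m → m ≤ 5 → 3 ≤ 2 ^ m → ¬ Loop Step (2 ^ m)
¬loop m m≤5 3≤2^m L with ℕ.anyUpTo? (λ k → across? (Loop.x L k) (Loop.x L (suc k))) (2 ^ m)
... | yes (k , _ , across) =
  Crossing.¬across 3≤2^m (ℕ.^-monoʳ-≤ 2 m≤5) (rotate L k) across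
... | no ¬across = ¬confined m 3≤2^m L λ k k<ℓ →
  [ (λ inside → inside) , (λ across → contradiction (k , k<ℓ , across) ¬across) ]′ (Loop.walk L k)

G₄₅₀-noPowerOfTwoCycles : NoPowerOfTwoCycles 5 G₄₅₀
G₄₅₀-noPowerOfTwoCycles m m≤5 c = ¬loop m m≤5 (Cycle.3≤ℓ c)
  (mapLoop (unroll c) decode decode-injective
    (λ u v → toWitness {a? = step? (decode u) (decode v)}))

mainTheorem3 : (Σ[ G ∈ Graph 450 ] (IsCubic G × NoPowerOfTwoCycles 5 G))
    × (∃[ n ] ((f 5 is n) × n ≤ 450))
mainTheorem3 = witness , least (isAdmissibleOrder? 5) 450 (_ , witness)
  where
  witness : Σ[ G ∈ Graph 450 ] (IsCubic G × NoPowerOfTwoCycles 5 G)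
  witness = G₄₅₀ , G₄₅₀-cubic , G₄₅₀-noPowerOfTwoCycles
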